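{- Let $k \leq n$ be positive integers and let $\lambda = (\lambda_1 \geq \cdots \geq \lambda_s\ge0)$ be a partition of $k$ into $s$ nonnegative parts. If $f \in V_{n,\lambda}$ is any nonzero polynomial whose lexicographically largest monomial is $x_1^{c_1}x_2^{c_2}\cdots x_n^{c_n}$, then $(c_1,\dots,c_n)\in\mathcal{C}_{n,\lambda}$.
   Context: Lexicographic order: $x^{a}<x^{b}$ iff there is $i$ with $a_1=b_1,\dots,a_{i-1}=b_{i-1}$ and $a_i<b_i$. $\lambda'=(\lambda'_1,\dots,\lambda'_n)$ is the conjugate of $\lambda$ padded with zeros ($\lambda'_j=\#\{i:\lambda_i\ge j\}$). $e_d(S)$ is the degree $d$ elementary symmetric polynomial in $\{x_i:i\in S\}$ (zero if $d>|S|$). $I_{n,\lambda}\subseteq\mathbb{Q}[x_1,\dots,x_n]$ is generated by $x_1^s,\dots,x_n^s$ and all $e_d(S)$ with $S\subseteq[n]$, $d>|S|-\lambda'_n-\cdots-\lambda'_{n-|S|+1}$. With $f\odot g=f(\partial/\partial x_1,\dots,\partial/\partial x_n)(g)$ and $\langle f,g\rangle$ the constant term of $f\odot g$, $V_{n,\lambda}=\{g:\langle f,g\rangle=0\ \forall f\in I_{n,\lambda}\}$. $\mathcal{C}_{n,\lambda}$ is the set of length-$n$ sequences of nonnegative integers that are componentwise $\le$ some shuffle (order-preserving interleaving) of the sequences $(\lambda'_j-1,\dots,1,0)$ for $j=1,\dots,k$ (empty when $\lambda'_j=0$) and the constant sequence $(s-1,\dots,s-1)$ of length $n-k$. -}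

module Defs where

open import Data.Nat as ℕ using (ℕ; zero; suc; _≤_; _<_; _∸_; _≟_; _≤ᵇ_)
open import Data.Nat.Combinatorics using (_P_)
open import Data.Integer using (+_)
open import Data.Rational as Q using (ℚ; 0ℚ; 1ℚ)
open import Data.Bool using (Bool; true; false; if_then_else_)
open import Data.Fin as F using (Fin)
open import Data.Fin.Subset using (Subset; ∣_∣)
open import Data.Vec as V using (Vec; []; _∷_; lookup)
open import Data.Vec.Properties using (≡-dec)
open import Data.List as L using (List; []; _∷_; _++_; map; concatMap; downFrom; replicate)
open import Data.List.Relation.Unary.All using (All)
open import Data.List.Relation.Binary.Pointwise using (Pointwise)
open import Data.List.Relation.Ternary.Interleaving.Propositional using (Interleaving)
open import Data.Product using (Σ; ∃; _×_; _,_; proj₁; proj₂)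
open import Data.Sum using (_⊎_)
open import Data.Empty using (⊥)
open import Relation.Nullary using (¬_; yes; no)
open import Relation.Binary.PropositionalEquality using (_≡_)

-- Polynomials in Q[x_1..x_n], represented as formal finite sums of
-- terms (coefficient, exponent vector).  Two representations denote the
-- same polynomial iff they have the same coefficient function.

Exp : ℕ → Set
Exp n = Vec ℕ n

Poly : ℕ → Set
Poly n = List (ℚ × Exp n)

ℕ→ℚ : ℕ → ℚ
ℕ→ℚ m = (+ m) Q./ 1

coeff : ∀ {n} → Poly n → Exp n → ℚ
coeff [] a = 0ℚ
coeff ((q , b) ∷ p) a with ≡-dec _≟_ b a
... | yes _ = q Q.+ coeff p a
... | no  _ = coeff p a

_≈P_ : ∀ {n} → Poly n → Poly n → Set
p ≈P q = ∀ a → coeff p a ≡ coeff q a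

zeroExp : ∀ n → Exp n
zeroExp n = V.replicate n 0

_+P_ : ∀ {n} → Poly n → Poly n → Poly n
p +P q = p ++ q

_*P_ : ∀ {n} → Poly n → Poly n → Poly n
p *P q = concatMap (λ { (α , a) → map (λ { (β , b) → (α Q.* β , V.zipWith ℕ._+_ a b) }) q }) p

sumP : ∀ {n} → List (Poly n) → Poly n
sumP = L.foldr _+P_ []

-- Differential operator action  f ⊙ g = f(∂/∂x_1,…,∂/∂x_n)(g)
-- on monomials: ∂^a x^b = (∏ b_i (b_i-1)…(b_i-a_i+1)) x^(b-a)
-- (the falling factorial b_i P a_i is 0 when a_i > b_i).

fallProd : ∀ {n} → Exp n → Exp n → ℕ
fallProd [] [] = 1
fallProd (a ∷ as) (b ∷ bs) = (b P a) ℕ.* fallProd as bs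

_⊙_ : ∀ {n} → Poly n → Poly n → Poly n
f ⊙ g = concatMap (λ { (α , a) → map (λ { (β , b) →
          (α Q.* β Q.* ℕ→ℚ (fallProd a b) , V.zipWith _∸_ b a) }) g }) f

⟨_,_⟩ : ∀ {n} → Poly n → Poly n → ℚ
⟨_,_⟩ {n} f g = coeff (f ⊙ g) (zeroExp n)

xpow : ∀ {n} → Fin n → ℕ → Poly n
xpow {n} i s = (1ℚ , V.updateAt (zeroExp n) i (λ _ → s)) ∷ []

-- elementary symmetric polynomial e_d(S) in the variables {x_i : i ∈ S}
-- (recursion e_d(S ∪ {x}) = e_d(S) + x e_{d-1}(S); zero if d > |S|)
esym : ∀ {n} → ℕ → Subset n → Poly n
esym zero    [] = (1ℚ , []) ∷ []
esym (suc d) [] = []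
esym d (false ∷ S) = map (λ { (q , a) → (q , 0 ∷ a) }) (esym d S)
esym zero (true ∷ S) = map (λ { (q , a) → (q , 0 ∷ a) }) (esym zero S)
esym (suc d) (true ∷ S) =
  map (λ { (q , a) → (q , 0 ∷ a) }) (esym (suc d) S) ++
  map (λ { (q , a) → (q , 1 ∷ a) }) (esym d S)

conj : ∀ {s} → Vec ℕ s → ℕ → ℕ
conj [] j = 0
conj (x ∷ xs) j = (if j ≤ᵇ x then 1 else 0) ℕ.+ conj xs j

tailSum : ∀ {s} → ℕ → Vec ℕ s → ℕ → ℕ
tailSum n la zero = 0
tailSum n la (suc m) = conj la (n ∸ m) ℕ.+ tailSum n la m

data IsGen (n : ℕ) {s : ℕ} (la : Vec ℕ s) : Poly n → Set where
  genPow : (i : Fin n) → IsGen n la (xpow i s)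
  genE   : (S : Subset n) (d : ℕ) →
           ∣ S ∣ ∸ tailSum n la ∣ S ∣ < d → IsGen n la (esym d S)

InIdeal : (n : ℕ) {s : ℕ} (la : Vec ℕ s) → Poly n → Set
InIdeal n la f = Σ (List (Poly n × Poly n)) λ qs →
  All (λ qh → IsGen n la (proj₂ qh)) qs ×
  (f ≈P sumP (map (λ qh → proj₁ qh *P proj₂ qh) qs))

InV : (n : ℕ) {s : ℕ} (la : Vec ℕ s) → Poly n → Set
InV n la g = ∀ f → InIdeal n la f → ⟨ f , g ⟩ ≡ 0ℚ

_<lex_ : ∀ {n} → Exp n → Exp n → Set
[] <lex [] = ⊥
(a ∷ as) <lex (b ∷ bs) = a < b ⊎ (a ≡ b × as <lex bs)

IsLexLeading : ∀ {n} → Poly n → Exp n → Set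
IsLexLeading f c = ¬ (coeff f c ≡ 0ℚ) × (∀ b → ¬ (coeff f b ≡ 0ℚ) → b ≡ c ⊎ b <lex c)

NonZeroP : ∀ {n} → Poly n → Set
NonZeroP f = ∃ λ a → ¬ (coeff f a ≡ 0ℚ)

IsPartition : ℕ → ∀ {s} → Vec ℕ s → Set
IsPartition k {s} la = (∀ (i j : Fin s) → i F.≤ j → lookup la j ≤ lookup la i) × V.sum la ≡ k

Shuffle : List (List ℕ) → List ℕ → Set
Shuffle [] w = w ≡ []
Shuffle (l ∷ ls) w = ∃ λ u → Shuffle ls u × Interleaving l u w

blocks : (n k s : ℕ) → Vec ℕ s → List (List ℕ)
blocks n k s la = map (λ j → downFrom (conj la j)) (L.map suc (L.upTo k))
                  ++ (replicate (n ∸ k) (s ∸ 1) ∷ [])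

InC : (n k s : ℕ) → Vec ℕ s → Exp n → Set
InC n k s la c = ∃ λ w → Shuffle (blocks n k s la) w × Pointwise _≤_ (V.toList c) w

{-# OPTIONS --safe #-}
module Submission where

-- A polynomial g yields the functional L(xᵃ) = ⟨xᵃ, g⟩ = a! · coeff g a, which has the same
-- support as g and annihilates the ideal when g ∈ V. We induct on n, slicing L at the leading
-- exponent d of x₁. Let cs be the list of columns λ′_j, and cs′ the list obtained by shortening
-- by one the last column exceeding d (cs′ = cs if there is none). Since L vanishes on x₁^(d+1),
-- it suffices to show x₁^d e_r(S) ∈ I_{n,cs} + (x₁^(d+1)) for the generators e_r(S) of
-- I_{n-1,cs′}, and this follows from e_{r+1}(S ∪ {1}) = e_{r+1}(S) + x₁ e_r(S). On the
-- combinatorial side, the shortened column (or the constant sequence) supplies a letter ≥ d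
-- in front of a shuffle for cs′.

open import Defs
open import Data.Nat using (ℕ; _≤_)
open import Data.Vec using (Vec)

open import Data.Nat using (zero; suc; _+_; _*_; _∸_; _<_; _≥_; _≟_; z≤n; s≤s; z<s; _≤ᵇ_; _<ᵇ_; _≤?_; NonZero; >-nonZero)
open import Data.Nat.Properties
open import Algebra.Properties.CommutativeSemigroup +-commutativeSemigroup using (interchange)
open import Data.Nat.ListAction using (sum)
open import Data.Nat.Combinatorics using (_P_; nPn≡n!)
open import Data.Nat.Combinatorics.Specification using (k>n⇒nPk≡0)
open import Data.Rational as ℚ using (ℚ; 0ℚ; 1ℚ)
import Data.Rational.Properties as ℚ
open import Data.Rational.Solver using (module +-*-Solver)
open import Data.Bool using (true; false; T; if_then_else_)
open import Data.Fin as Fin using ()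
open import Data.Fin.Subset using (Subset; ∣_∣; ⊤)
open import Data.Fin.Subset.Properties using (∣p∣≤n; ∣⊤∣≡n)
open import Data.Vec as Vec using ([]; _∷_; zipWith)
open import Data.Vec.Properties using (≡-dec; zipWith-identityʳ)
open import Data.List using (List; []; _∷_; _++_; map; drop; downFrom; replicate; applyUpTo; upTo)
open import Data.List.Properties using (map-∘; map-upTo; ++-identityʳ; drop-all; length-applyUpTo)
open import Data.List.Relation.Unary.All as All using (All; []; _∷_)
open import Data.List.Relation.Unary.All.Properties using (drop⁺)
open import Data.List.Relation.Unary.AllPairs using (AllPairs; []; _∷_)
open import Data.List.Relation.Unary.AllPairs.Properties using (applyUpTo⁺₁)
open import Data.List.Relation.Binary.Pointwise using (Pointwise; []; _∷_)
open import Data.List.Relation.Ternary.Interleaving.Propositional using ([]; consˡ; consʳ)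
open import Data.Product using (∃; _×_; _,_; proj₁)
open import Data.Sum using (_⊎_; inj₁; inj₂)
open import Data.Empty using (⊥-elim)
open import Function using (_∘_)
open import Relation.Nullary using (¬_; yes; no; contradiction)
open import Relation.Nullary.Decidable using (decidable-stable)
open import Relation.Binary.PropositionalEquality using (_≡_; _≢_; refl; sym; trans; cong; cong₂; subst; subst₂; module ≡-Reasoning)

-- Linear functionals on polynomials

-- A linear functional on polynomials, given by its values on monomials.
Functional : ℕ → Set
Functional n = Exp n → ℚ

eval : ∀ {n} → Functional n → Poly n → ℚ
eval L []            = 0ℚ
eval L ((q , a) ∷ p) = q ℚ.* L a ℚ.+ eval L p

-- This is p ↦ L(xᵃ p). By linearity, `L` kills the ideal generated by h once `eval (shift a L) h`
-- vanishes for every `a`.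
shift : ∀ {n} → Exp n → Functional n → Functional n
shift a L b = L (zipWith _+_ a b)

eval-++ : ∀ {n} (L : Functional n) p q → eval L (p ++ q) ≡ eval L p ℚ.+ eval L q
eval-++ L []            q = sym (ℚ.+-identityˡ _)
eval-++ L ((α , a) ∷ p) q =
  trans (cong (α ℚ.* L a ℚ.+_) (eval-++ L p q)) (sym (ℚ.+-assoc (α ℚ.* L a) (eval L p) (eval L q)))

eval-cong : ∀ {n} {L M : Functional n} → (∀ a → L a ≡ M a) → ∀ p → eval L p ≡ eval M p
eval-cong eq []            = refl
eval-cong eq ((α , a) ∷ p) = cong₂ (λ x y → α ℚ.* x ℚ.+ y) (eq a) (eval-cong eq p)

eval-zero : ∀ {n} {L : Functional n} → (∀ a → L a ≡ 0ℚ) → ∀ p → eval L p ≡ 0ℚ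
eval-zero eq []            = refl
eval-zero eq ((α , a) ∷ p) rewrite eq a | eval-zero eq p | ℚ.*-zeroʳ α = refl

eval-map : ∀ {m n} {L : Functional n} φ (u : Exp m → Exp n) →
  (∀ q a → φ (q , a) ≡ (q , u a)) → ∀ p → eval L (map φ p) ≡ eval (L ∘ u) p
eval-map φ u eq []            = refl
eval-map {L = L} φ u eq ((α , a) ∷ p) rewrite eq α a =
  cong (α ℚ.* L (u a) ℚ.+_) (eval-map φ u eq p)

eval-esym-false : ∀ {n} (L : Functional (suc n)) r S →
  eval L (esym r (false ∷ S)) ≡ eval (L ∘ (0 ∷_)) (esym r S)
eval-esym-false L zero    S = eval-map _ (0 ∷_) (λ _ _ → refl) (esym 0 S)
eval-esym-false L (suc r) S = eval-map _ (0 ∷_) (λ _ _ → refl) (esym (suc r) S)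

eval-esym-true : ∀ {n} (L : Functional (suc n)) r S →
  eval L (esym (suc r) (true ∷ S)) ≡
  eval (L ∘ (0 ∷_)) (esym (suc r) S) ℚ.+ eval (L ∘ (1 ∷_)) (esym r S)
eval-esym-true L r S = trans (eval-++ L (map _ (esym (suc r) S)) _)
  (cong₂ ℚ._+_ (eval-map _ (0 ∷_) (λ _ _ → refl) (esym (suc r) S))
               (eval-map _ (1 ∷_) (λ _ _ → refl) (esym r S)))

eval-esym-zero : ∀ {n} (L : Functional n) S → eval L (esym 0 S) ≡ L (zeroExp n)
eval-esym-zero L [] = trans (ℚ.+-identityʳ _) (ℚ.*-identityˡ _)
eval-esym-zero L (false ∷ S) =
  trans (eval-map _ (0 ∷_) (λ _ _ → refl) (esym 0 S)) (eval-esym-zero _ S)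
eval-esym-zero L (true ∷ S) =
  trans (eval-map _ (0 ∷_) (λ _ _ → refl) (esym 0 S)) (eval-esym-zero _ S)

eval-xpow : ∀ {n} (L : Functional n) i s →
  eval L (xpow i s) ≡ L (Vec.updateAt (zeroExp n) i (λ _ → s))
eval-xpow L i s = trans (ℚ.+-identityʳ _) (ℚ.*-identityˡ _)

-- The functional paired with a polynomial

weight : ∀ {n} → Exp n → ℚ
weight a = ℕ→ℚ (fallProd a a)

dual : ∀ {n} → Poly n → Functional n
dual g a = weight a ℚ.* coeff g a

coeff-++ : ∀ {n} (p q : Poly n) a → coeff (p ++ q) a ≡ coeff p a ℚ.+ coeff q a
coeff-++ []            q a = sym (ℚ.+-identityˡ _)
coeff-++ ((α , b) ∷ p) q a with ≡-dec _≟_ b a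
... | yes _ = trans (cong (α ℚ.+_) (coeff-++ p q a)) (sym (ℚ.+-assoc α (coeff p a) (coeff q a)))
... | no  _ = coeff-++ p q a

∸-self : ∀ {n} (a : Exp n) → zipWith _∸_ a a ≡ zeroExp n
∸-self []      = refl
∸-self (x ∷ a) = cong₂ _∷_ (n∸n≡0 x) (∸-self a)

-- Truncated subtraction yields the zero exponent for every b ≤ a, not only for b = a. In the
-- remaining cases some entry of `b` is smaller than that of `a`, and there the falling factorial is
-- zero.
fallProd≡0 : ∀ {n} (a b : Exp n) → zipWith _∸_ b a ≡ zeroExp n → b ≢ a → fallProd a b ≡ 0
fallProd≡0 []      []      _  b≢a = contradiction refl b≢a
fallProd≡0 (x ∷ a) (y ∷ b) eq b≢a with y ≟ x
... | yes refl = trans (cong ((y P x) *_) (fallProd≡0 a b (cong Vec.tail eq) (b≢a ∘ cong (x ∷_))))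
                       (*-zeroʳ (y P x))
... | no y≢x = cong (_* fallProd a b)
  (k>n⇒nPk≡0 (≤∧≢⇒< (m∸n≡0⇒m≤n (cong Vec.head eq)) y≢x))

private
  collect : ∀ α β w c → α ℚ.* β ℚ.* w ℚ.+ α ℚ.* (w ℚ.* c) ≡ α ℚ.* (w ℚ.* (β ℚ.+ c))
  collect = solve 4 (λ α β w c → α :* β :* w :+ α :* (w :* c) := α :* (w :* (β :+ c))) refl
    where open +-*-Solver

monomial-pairing : ∀ {n} α (a : Exp n) g → ⟨ (α , a) ∷ [] , g ⟩ ≡ α ℚ.* dual g a
monomial-pairing α a [] = sym (trans (cong (α ℚ.*_) (ℚ.*-zeroʳ (weight a))) (ℚ.*-zeroʳ α))
monomial-pairing {n} α a ((β , b) ∷ g)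
  with ≡-dec _≟_ (zipWith _∸_ b a) (zeroExp n) | ≡-dec _≟_ b a | monomial-pairing α a g
... | yes _  | yes refl | ih =
  trans (cong (α ℚ.* β ℚ.* weight a ℚ.+_) ih) (collect α β (weight a) (coeff g a))
... | yes eq | no b≢a   | ih rewrite fallProd≡0 a b eq b≢a | ℚ.*-zeroʳ (α ℚ.* β) =
  trans (ℚ.+-identityˡ _) ih
... | no ≢0  | yes refl | ih = contradiction (∸-self a) ≢0
... | no _   | no _     | ih = ih

pairing : ∀ {n} (f g : Poly n) → ⟨ f , g ⟩ ≡ eval (dual g) f
pairing []            g = refl
pairing {n} ((α , a) ∷ f) g =
  trans (coeff-++ (map _ g) (f ⊙ g) (zeroExp n))
        (cong₂ ℚ._+_ (trans (cong (λ p → coeff p (zeroExp n)) (sym (++-identityʳ (map _ g))))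
                            (monomial-pairing α a g))
                     (pairing f g))

eval-monomial-* : ∀ {n} (L : Functional n) a h →
  eval L (((1ℚ , a) ∷ []) *P h) ≡ eval (shift a L) h
eval-monomial-* L a h = trans (cong (eval L) (++-identityʳ (map _ h)))
  (eval-map _ (zipWith _+_ a) (λ q b → cong (_, zipWith _+_ a b) (ℚ.*-identityˡ q)) h)

fallProd-nonZero : ∀ {n} (a : Exp n) → NonZero (fallProd a a)
fallProd-nonZero []      = _
fallProd-nonZero (x ∷ a) = m*n≢0 (x P x) _
  {{subst NonZero (sym (nPn≡n! x)) (x !≢0)}} {{fallProd-nonZero a}}

*-pos-≡0 : ∀ p .{{_ : ℚ.Positive p}} q → p ℚ.* q ≡ 0ℚ → q ≡ 0ℚ
*-pos-≡0 p q eq = ℚ.≤-antisym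
  (ℚ.*-cancelˡ-≤-pos p (ℚ.≤-reflexive pq≡p0))
  (ℚ.*-cancelˡ-≤-pos p (ℚ.≤-reflexive (sym pq≡p0)))
  where pq≡p0 = trans eq (sym (ℚ.*-zeroʳ p))

-- The weight is a!, hence positive, so passing to `dual g` loses no monomial of g.
dual≡0 : ∀ {n} (g : Poly n) a → dual g a ≡ 0ℚ → coeff g a ≡ 0ℚ
dual≡0 g a = *-pos-≡0 (weight a)
  {{ℚ.normalize-pos (fallProd a a) 1 {{_}} {{fallProd-nonZero a}}}} (coeff g a)

-- Annihilating functionals and their slices

-- cs lists the columns λ′_j, so sum (drop (n ∸ m) cs) is λ′_n + ⋯ + λ′_{n-m+1}; the bound
-- r > m − (λ′_n + ⋯ + λ′_{n-m+1}) is stated without truncated subtraction.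
record Annihilates {n} (s : ℕ) (cs : List ℕ) (L : Functional n) : Set where
  field
    powers     : ∀ i a → shift a L (Vec.updateAt (zeroExp n) i (λ _ → s)) ≡ 0ℚ
    symmetrics : ∀ S r a → 0 < r → ∣ S ∣ < r + sum (drop (n ∸ ∣ S ∣) cs) →
                 eval (shift a L) (esym r S) ≡ 0ℚ

open Annihilates

+-zero-right : ∀ {p q} → p ℚ.+ q ≡ 0ℚ → p ≡ 0ℚ → q ≡ 0ℚ
+-zero-right {q = q} eq refl = trans (sym (ℚ.+-identityˡ q)) eq

+-zero-left : ∀ {p q} → p ℚ.+ q ≡ 0ℚ → q ≡ 0ℚ → p ≡ 0ℚ
+-zero-left {p} eq refl = trans (sym (ℚ.+-identityʳ p)) eq

-- With E r x standing for x₁ˣ e_r(S), the recurrence is the vanishing of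
-- e_{r+1}(S ∪ {1}) = e_{r+1}(S) + x₁ e_r(S): one e-degree is traded for one power of x₁.
trade : ∀ (E : ℕ → ℕ → ℚ) d r → (∀ q x → r ≤ q → E (suc q) x ℚ.+ E q (suc x) ≡ 0ℚ) →
  E (d + r) 0 ≡ 0ℚ → E r d ≡ 0ℚ
trade E zero    r rec top = top
trade E (suc d) r rec top = +-zero-right (rec r d ≤-refl)
  (trade E d (suc r) (λ q x r<q → rec q x (<⇒≤ r<q))
    (subst (λ j → E j 0 ≡ 0ℚ) (sym (+-suc d r)) top))

sum-drop-suc : ∀ {d} i cs → All (_≤ d) (drop i cs) →
  sum (drop i cs) ≤ d + sum (drop (suc i) cs)
sum-drop-suc zero    []       _         = z≤n
sum-drop-suc zero    (c ∷ cs) (c≤d ∷ _) = +-monoˡ-≤ (sum cs) c≤d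
sum-drop-suc (suc i) []       _         = z≤n
sum-drop-suc (suc i) (c ∷ cs) all       = sum-drop-suc i cs all

module _ {n s cs} {L : Functional (suc n)} (ann : Annihilates s cs L)
         (S : Subset n) (a : Exp n) where

  private
    E : ℕ → ℕ → ℚ
    E r x = eval (λ b → L (x ∷ zipWith _+_ a b)) (esym r S)

    tail = sum (drop (n ∸ ∣ S ∣) cs)

  -- Adjoining x₁ to S raises both the size of the set and the number of variables by one, so the
  -- same tail of columns bounds the degrees for S ∪ {1}.
  esym-recurrence : ∀ r x → ∣ S ∣ < r + tail → E (suc r) x ℚ.+ E r (suc x) ≡ 0ℚ
  esym-recurrence r x lt = begin
    E (suc r) x ℚ.+ E r (suc x)
      ≡⟨ cong₂ ℚ._+_
           (eval-cong (λ b → cong (λ y → L (y ∷ zipWith _+_ a b)) (sym (+-identityʳ x))) (esym (suc r) S))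
           (eval-cong (λ b → cong (λ y → L (y ∷ zipWith _+_ a b)) (+-comm 1 x)) (esym r S)) ⟩
    eval (shift (x ∷ a) L ∘ (0 ∷_)) (esym (suc r) S) ℚ.+ eval (shift (x ∷ a) L ∘ (1 ∷_)) (esym r S)
      ≡⟨ eval-esym-true (shift (x ∷ a) L) r S ⟨
    eval (shift (x ∷ a) L) (esym (suc r) (true ∷ S))
      ≡⟨ symmetrics ann (true ∷ S) (suc r) (x ∷ a) z<s (s≤s lt) ⟩
    0ℚ ∎
    where open ≡-Reasoning

  -- Leaving x₁ out keeps the size of S while the number of variables grows by one, so the tail
  -- starts one column later.
  esym-base : ∀ r → 0 < r → ∣ S ∣ < r + sum (drop (suc (n ∸ ∣ S ∣)) cs) → E r 0 ≡ 0ℚ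
  esym-base r 0<r lt = trans (sym (eval-esym-false (shift (0 ∷ a) L) r S))
    (symmetrics ann (false ∷ S) r (0 ∷ a) 0<r
      (subst (λ i → ∣ S ∣ < r + sum (drop i cs)) (sym (+-∸-assoc 1 (∣p∣≤n S))) lt))

  -- The degree r is raised by d at the cost of dropping one more column, of length at most d.
  esym-short-columns : ∀ d r → 0 < d + r → All (_≤ d) (drop (n ∸ ∣ S ∣) cs) →
    ∣ S ∣ < r + tail → E r d ≡ 0ℚ
  esym-short-columns d r 0<d+r short lt =
    trade E d r (λ q x r≤q → esym-recurrence q x (<-≤-trans lt (+-monoˡ-≤ tail r≤q)))
      (esym-base (d + r) 0<d+r (<-≤-trans lt bound))
    where
    open ≤-Reasoning
    tail′ = sum (drop (suc (n ∸ ∣ S ∣)) cs)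
    bound : r + tail ≤ d + r + tail′
    bound = begin
      r + tail         ≤⟨ +-monoʳ-≤ r (sum-drop-suc (n ∸ ∣ S ∣) cs short) ⟩
      r + (d + tail′)  ≡⟨ +-assoc r d tail′ ⟨
      r + d + tail′    ≡⟨ cong (_+ tail′) (+-comm r d) ⟩
      d + r + tail′    ∎

  esym-slice : ∀ d r → (∀ b → L (suc d ∷ b) ≡ 0ℚ) → ∣ S ∣ < r + tail → E (suc r) d ≡ 0ℚ
  esym-slice d r above lt =
    +-zero-left (esym-recurrence r d lt) (eval-zero (λ b → above _) (esym r S))

-- If the tail lost one box, the bound for `cs′` in degree r + 1 is the bound for `cs` in degree r.
-- The recurrence then applies, and its second term carries x₁^(d+1), which `above` kills. If the
-- tail is unchanged, its columns are short enough to trade all d powers of x₁.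
slice-annihilates : ∀ {n s d cs cs′} {L : Functional (suc n)} → Annihilates s cs L →
  (∀ b → L (suc d ∷ b) ≡ 0ℚ) →
  (∀ i → suc (sum (drop i cs′)) ≡ sum (drop i cs) ⊎
         drop i cs′ ≡ drop i cs × All (_≤ d) (drop i cs)) →
  Annihilates s cs′ (L ∘ (d ∷_))
powers (slice-annihilates {d = d} {L = L} ann above drops) i a =
  trans (cong (λ x → L (x ∷ _)) (sym (+-identityʳ d))) (powers ann (Fin.suc i) (d ∷ a))
symmetrics (slice-annihilates {n} {d = d} {cs} {cs′} ann above drops) S (suc r) a 0<r lt
  with drops (n ∸ ∣ S ∣)
... | inj₁ eq = esym-slice ann S a d r above
  (<-≤-trans lt (≤-reflexive (trans (sym (+-suc r _)) (cong (_+_ r) eq))))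
... | inj₂ (eq , short) = esym-short-columns ann S a d (suc r)
  (<-≤-trans 0<r (m≤n+m (suc r) d)) short
  (subst (λ xs → ∣ S ∣ < suc r + sum xs) eq lt)

-- Shortening the last long column

data Decrement (d : ℕ) : List ℕ → List ℕ → Set where
  here  : ∀ {c cs} → d ≤ c → All (_≤ d) cs → Decrement d (suc c ∷ cs) (c ∷ cs)
  there : ∀ {c cs cs′} → Decrement d cs cs′ → Decrement d (c ∷ cs) (c ∷ cs′)

decrement-sum : ∀ {d cs cs′} → Decrement d cs cs′ → suc (sum cs′) ≡ sum cs
decrement-sum (here _ _)      = refl
decrement-sum (there {c} dec) = trans (sym (+-suc c _)) (cong (_+_ c) (decrement-sum dec))

-- A tail containing the shortened column loses one box. A tail to its right is intact, and its
-- columns are at most `d` because the last column exceeding `d` was chosen.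
decrement-drop : ∀ {d cs cs′} → Decrement d cs cs′ → ∀ i →
  suc (sum (drop i cs′)) ≡ sum (drop i cs) ⊎ drop i cs′ ≡ drop i cs × All (_≤ d) (drop i cs)
decrement-drop dec            zero    = inj₁ (decrement-sum dec)
decrement-drop (here _ short) (suc i) = inj₂ (refl , drop⁺ i short)
decrement-drop (there dec)    (suc i) = decrement-drop dec i

decrement-bounded : ∀ {d m cs cs′} → Decrement d cs cs′ → All (_≤ m) cs → All (_≤ m) cs′
decrement-bounded (here _ _)  (c<m ∷ ≤m) = <⇒≤ c<m ∷ ≤m
decrement-bounded (there dec) (c≤m ∷ ≤m) = c≤m ∷ decrement-bounded dec ≤m

-- The tail is searched first, so the head is shortened only when no later column exceeds `d`; the
-- shortened head is still at least `d`, which keeps the list sorted.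
decrement? : ∀ d {cs} → AllPairs _≥_ cs →
  All (_≤ d) cs ⊎ ∃ λ cs′ → Decrement d cs cs′ × AllPairs _≥_ cs′
decrement? d [] = inj₁ []
decrement? d {c ∷ cs} (c≥ ∷ sorted) with decrement? d sorted
... | inj₂ (cs′ , dec , sorted′) = inj₂ (c ∷ cs′ , there dec , decrement-bounded dec c≥ ∷ sorted′)
... | inj₁ short with c ≤? d
...   | yes c≤d = inj₁ (c≤d ∷ short)
...   | no  c≰d with s≤s d≤c ← ≰⇒> c≰d =
  inj₂ (_ , here d≤c short , All.map (λ x≤d → ≤-trans x≤d d≤c) short ∷ sorted)

-- Shuffles of the columns

columns : ℕ → ℕ → List ℕ → List (List ℕ)
columns t m cs = map downFrom cs ++ replicate t m ∷ []

-- As `downFrom (suc c)` is `c ∷ downFrom c`, restoring the shortened column adds the letter c ≥ d,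
-- which may precede the whole word.
shuffle-decrement : ∀ {t m d cs cs′ w} → Decrement d cs cs′ → Shuffle (columns t m cs′) w →
  ∃ λ x → d ≤ x × Shuffle (columns t m cs) (x ∷ w)
shuffle-decrement (here d≤c _) (u , sh , il) = _ , d≤c , u , sh , consˡ il
shuffle-decrement (there dec)  (u , sh , il) with shuffle-decrement dec sh
... | x , d≤x , sh′ = x , d≤x , x ∷ u , sh′ , consʳ il

shuffle-constant : ∀ {t m} cs {w} → Shuffle (columns t m cs) w →
  Shuffle (columns (suc t) m cs) (m ∷ w)
shuffle-constant []       (u , sh , il) = u , sh , consˡ il
shuffle-constant (c ∷ cs) (u , sh , il) = _ , shuffle-constant cs sh , consʳ il

shuffle-empty : ∀ m cs → sum cs ≡ 0 → Shuffle (columns 0 m cs) []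
shuffle-empty m []          _  = [] , refl , []
shuffle-empty m (zero ∷ cs) eq = [] , shuffle-empty m cs eq , []

-- Leading exponents and the induction

LexLeading : ∀ {n} → Functional n → Exp n → Set
LexLeading L c = L c ≢ 0ℚ × (∀ b → L b ≢ 0ℚ → b ≡ c ⊎ b <lex c)

lexLeading-above : ∀ {n d e c} {L : Functional (suc n)} → LexLeading L (d ∷ c) → d < e →
  ∀ b → L (e ∷ b) ≡ 0ℚ
lexLeading-above {d = d} {e} {L = L} (_ , max) d<e b =
  decidable-stable (L (e ∷ b) ℚ.≟ 0ℚ) λ ≢0 → absurd (max (e ∷ b) ≢0)
  where
  absurd : ¬ (e ∷ b ≡ d ∷ _ ⊎ (e ∷ b) <lex (d ∷ _))
  absurd (inj₁ refl)              = <-irrefl refl d<e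
  absurd (inj₂ (inj₁ e<d))        = <-asym d<e e<d
  absurd (inj₂ (inj₂ (refl , _))) = <-irrefl refl d<e

lexLeading-slice : ∀ {n d c} {L : Functional (suc n)} → LexLeading L (d ∷ c) →
  LexLeading (L ∘ (d ∷_)) c
lexLeading-slice {d = d} {c} (Lc≢0 , max) = Lc≢0 , λ b ≢0 → tail-max (max (d ∷ b) ≢0)
  where
  tail-max : ∀ {b} → d ∷ b ≡ d ∷ c ⊎ (d ∷ b) <lex (d ∷ c) → b ≡ c ⊎ b <lex c
  tail-max (inj₁ refl)            = inj₁ refl
  tail-max (inj₂ (inj₁ d<d))      = contradiction d<d (<-irrefl refl)
  tail-max (inj₂ (inj₂ (_ , lt))) = inj₂ lt

sum-bounded-by-zero : ∀ {cs} → All (_≤ 0) cs → sum cs ≡ 0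
sum-bounded-by-zero []          = refl
sum-bounded-by-zero (z≤n ∷ all) = sum-bounded-by-zero all

-- If s ≤ d, the monomial is a multiple of x₁^s, which `L` kills.
leading-exponent-<s : ∀ {n s d cs c} {L : Functional (suc n)} → Annihilates s cs L →
  L (d ∷ c) ≢ 0ℚ → d < s
leading-exponent-<s {s = s} {d} {c = c} {L} ann ≢0 = ≰⇒> λ s≤d → ≢0 (begin
  L (d ∷ c)
    ≡⟨ cong₂ (λ x b → L (x ∷ b)) (m∸n+n≡m s≤d) (zipWith-identityʳ +-identityʳ c) ⟨
  L (d ∸ s + s ∷ zipWith _+_ c (zeroExp _))
    ≡⟨ powers ann Fin.zero (d ∸ s ∷ c) ⟩
  0ℚ ∎)
  where open ≡-Reasoning

-- Take S to be all n remaining variables and r = 0: the bound reads n < n + 1, and trading e_d(S)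
-- down to e_0(S) = 1 shows that `L` kills every multiple of x₁^d.
short-columns-impossible : ∀ {n s d cs c} {L : Functional (suc n)} → Annihilates s cs L →
  All (_≤ d) cs → sum cs ≡ suc n → ¬ (L (d ∷ c) ≢ 0ℚ)
short-columns-impossible {n} {s} {d} {cs} {c} {L} ann short total ≢0 = ≢0 (begin
  L (d ∷ c)
    ≡⟨ cong (λ b → L (d ∷ b)) (zipWith-identityʳ +-identityʳ c) ⟨
  L (d ∷ zipWith _+_ c (zeroExp n))
    ≡⟨ eval-esym-zero (λ b → L (d ∷ zipWith _+_ c b)) ⊤ ⟨
  eval (λ b → L (d ∷ zipWith _+_ c b)) (esym 0 ⊤)
    ≡⟨ esym-short-columns ann ⊤ c d 0 (subst (0 <_) (sym (+-identityʳ d)) 0<d)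
         (subst (λ i → All (_≤ d) (drop i cs)) 0≡n∸n short)
         (subst₂ (λ m i → m < sum (drop i cs)) (sym (∣⊤∣≡n n)) 0≡n∸n (≤-reflexive (sym total))) ⟩
  0ℚ ∎)
  where
  open ≡-Reasoning
  0≡n∸n : 0 ≡ n ∸ ∣ ⊤ {n} ∣
  0≡n∸n = sym (trans (cong (n ∸_) (∣⊤∣≡n n)) (n∸n≡0 n))
  0<d : 0 < d
  -- For d = 0 all columns would be empty, against their total n + 1.
  0<d = n≢0⇒n>0 λ { refl → 0≢1+n (trans (sym (sum-bounded-by-zero short)) total) }

-- Here `t` counts the constant letters still available, and `sum cs + t ≡ n` matches letters with
-- variables. A column exceeding `d` supplies the next letter; otherwise a constant letter s - 1
-- does, and having none left is contradictory.
leading-exponent-bounded : ∀ {n} s cs t (L : Functional n) c → AllPairs _≥_ cs →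
  sum cs + t ≡ n → Annihilates s cs L → LexLeading L c →
  ∃ λ w → Shuffle (columns t (s ∸ 1) cs) w × Pointwise _≤_ (Vec.toList c) w
leading-exponent-bounded s cs t L [] sorted total ann lead
  rewrite m+n≡0⇒n≡0 (sum cs) total = [] , shuffle-empty (s ∸ 1) cs (m+n≡0⇒m≡0 (sum cs) total) , []
leading-exponent-bounded s cs t L (d ∷ c) sorted total ann lead with decrement? d sorted
... | inj₂ (cs′ , dec , sorted′)
  with w , sh , c≤w ← leading-exponent-bounded s cs′ t (L ∘ (d ∷_)) c sorted′
         (suc-injective (trans (cong (_+ t) (decrement-sum dec)) total))
         (slice-annihilates ann (lexLeading-above {L = L} lead ≤-refl) (decrement-drop dec))
         (lexLeading-slice {L = L} lead)
  with x , d≤x , sh′ ← shuffle-decrement dec sh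
  = x ∷ w , sh′ , d≤x ∷ c≤w
leading-exponent-bounded s cs zero L (d ∷ c) sorted total ann lead | inj₁ short =
  ⊥-elim (short-columns-impossible ann short (trans (sym (+-identityʳ _)) total) (proj₁ lead))
leading-exponent-bounded s cs (suc t) L (d ∷ c) sorted total ann lead | inj₁ short
  with w , sh , c≤w ← leading-exponent-bounded s cs t (L ∘ (d ∷_)) c sorted
         (suc-injective (trans (sym (+-suc (sum cs) t)) total))
         -- The columns stay as they are, and all of them are at most `d`, so every tail falls under
         -- the second alternative.
         (slice-annihilates ann (lexLeading-above {L = L} lead ≤-refl)
            (λ i → inj₂ (refl , drop⁺ i short)))
         (lexLeading-slice {L = L} lead)
  = s ∸ 1 ∷ w , shuffle-constant cs sh
  , <⇒≤pred (leading-exponent-<s ann (proj₁ lead)) ∷ c≤w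

-- The conjugate partition

conjugate : ∀ {s} → ℕ → Vec ℕ s → List ℕ
conjugate k la = applyUpTo (conj la ∘ suc) k

conj-antitone : ∀ {s} (la : Vec ℕ s) {i j} → i ≤ j → conj la j ≤ conj la i
conj-antitone []       i≤j = z≤n
conj-antitone (x ∷ la) {i} {j} i≤j with j ≤ᵇ x in eqj | i ≤ᵇ x in eqi
... | false | false = conj-antitone la i≤j
... | false | true  = m≤n⇒m≤1+n (conj-antitone la i≤j)
... | true  | true  = s≤s (conj-antitone la i≤j)
... | true  | false =
  contradiction (≤⇒≤ᵇ (≤-trans i≤j (≤ᵇ⇒≤ j x (subst T (sym eqj) _)))) (subst T eqi)

sum-applyUpTo-+ : ∀ (f g : ℕ → ℕ) k →
  sum (applyUpTo (λ j → f j + g j) k) ≡ sum (applyUpTo f k) + sum (applyUpTo g k)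
sum-applyUpTo-+ f g zero    = refl
sum-applyUpTo-+ f g (suc k) =
  trans (cong (_+_ (f 0 + g 0)) (sum-applyUpTo-+ (f ∘ suc) (g ∘ suc) k))
        (interchange (f 0) (g 0) _ _)

sum-indicator : ∀ {x k} → x ≤ k → sum (applyUpTo (λ j → if j <ᵇ x then 1 else 0) k) ≡ x
sum-indicator {zero}  {zero}  _         = refl
sum-indicator {zero}  {suc k} _         = sum-indicator {zero} {k} z≤n
sum-indicator {suc x} {suc k} (s≤s x≤k) = cong suc (sum-indicator x≤k)

-- The boxes of the diagram are counted by rows: a part x ≤ k puts one box in each of the columns 1,
-- ..., x.
sum-conjugate : ∀ {s} (la : Vec ℕ s) {k} → Vec.sum la ≤ k → sum (conjugate k la) ≡ Vec.sum la
sum-conjugate []       {k} _  = sum-indicator {0} {k} z≤n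
sum-conjugate (x ∷ la) {k} ≤k =
  trans (sum-applyUpTo-+ (λ j → if j <ᵇ x then 1 else 0) (conj la ∘ suc) k)
        (cong₂ _+_ (sum-indicator (≤-trans (m≤m+n x _) ≤k))
                   (sum-conjugate la (≤-trans (m≤n+m _ x) ≤k)))

sum-drop-applyUpTo : ∀ f k i → sum (drop i (applyUpTo f k)) ≤ f i + sum (drop (suc i) (applyUpTo f k))
sum-drop-applyUpTo f zero    zero    = z≤n
sum-drop-applyUpTo f zero    (suc i) = z≤n
sum-drop-applyUpTo f (suc k) zero    = ≤-refl
sum-drop-applyUpTo f (suc k) (suc i) = sum-drop-applyUpTo (f ∘ suc) k i

-- This direction suffices: a larger `tailSum` admits more degrees in `genE`.
sum-drop≤tailSum : ∀ {s n k} (la : Vec ℕ s) m → k ≤ n → m ≤ n →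
  sum (drop (n ∸ m) (conjugate k la)) ≤ tailSum n la m
sum-drop≤tailSum {n = n} {k} la zero k≤n _ = ≤-reflexive (cong sum (drop-all n (conjugate k la)
  (≤-trans (≤-reflexive (length-applyUpTo (conj la ∘ suc) k)) k≤n)))
sum-drop≤tailSum {n = n} {k} la (suc m) k≤n m<n = begin
  sum (drop (n ∸ suc m) cs)
    ≤⟨ sum-drop-applyUpTo (conj la ∘ suc) k (n ∸ suc m) ⟩
  conj la (suc (n ∸ suc m)) + sum (drop (suc (n ∸ suc m)) cs)
    -- The list is indexed from 0 and the columns from 1; `m<n` keeps the subtraction from
    -- truncating.
    ≡⟨ cong (λ i → conj la i + sum (drop i cs)) (sym (+-∸-assoc 1 m<n)) ⟩
  conj la (n ∸ m) + sum (drop (n ∸ m) cs)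
    ≤⟨ +-monoʳ-≤ (conj la (n ∸ m)) (sum-drop≤tailSum la m k≤n (<⇒≤ m<n)) ⟩
  conj la (n ∸ m) + tailSum n la m ∎
  where
  open ≤-Reasoning
  cs = conjugate k la

-- From V to the bound on the leading exponent

dual-annihilates : ∀ {n s k} (la : Vec ℕ s) (g : Poly n) → k ≤ n → InV n la g →
  Annihilates s (conjugate k la) (dual g)
dual-annihilates {n} {s} {k} la g k≤n g∈V = record
  { powers     = λ i a → trans (sym (eval-xpow (shift a (dual g)) i s)) (vanish a (genPow i))
  ; symmetrics = λ S r a 0<r lt → vanish a (genE S r
      -- The bound in `genE` uses truncated subtraction, so it follows from the additive one only
      -- for positive r.
      (m<n+o⇒m∸n<o ∣ S ∣ (tailSum n la ∣ S ∣) {{>-nonZero 0<r}}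
        (<-≤-trans lt (≤-trans (+-monoʳ-≤ r (sum-drop≤tailSum la ∣ S ∣ k≤n (∣p∣≤n S)))
                               (≤-reflexive (+-comm r _))))))
  }
  where
  vanish : ∀ a {h} → IsGen n la h → eval (shift a (dual g)) h ≡ 0ℚ
  vanish a {h} gen = begin
    eval (shift a (dual g)) h     ≡⟨ eval-monomial-* (dual g) a h ⟨
    eval (dual g) (xᵃ *P h)       ≡⟨ pairing (xᵃ *P h) g ⟨
    -- A monomial multiple of a generator lies in the ideal with a single summand.
    ⟨ xᵃ *P h , g ⟩               ≡⟨ g∈V (xᵃ *P h) ((xᵃ , h) ∷ [] , gen ∷ [] ,
                                       λ b → cong (λ p → coeff p b) (sym (++-identityʳ (xᵃ *P h)))) ⟩
    0ℚ                            ∎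
    where
    open ≡-Reasoning
    xᵃ = (1ℚ , a) ∷ []

dual-lexLeading : ∀ {n} (g : Poly n) {c} → IsLexLeading g c → LexLeading (dual g) c
dual-lexLeading g {c} (≢0 , max) = ≢0 ∘ dual≡0 g c ,
  λ b db≢0 → max b λ eq → db≢0 (trans (cong (weight b ℚ.*_) eq) (ℚ.*-zeroʳ (weight b)))

blocks≡columns : ∀ n k s (la : Vec ℕ s) → blocks n k s la ≡ columns (n ∸ k) (s ∸ 1) (conjugate k la)
blocks≡columns n k s la = cong (_++ replicate (n ∸ k) (s ∸ 1) ∷ []) (begin
  map (downFrom ∘ conj la) (map suc (upTo k))  ≡⟨ map-∘ (map suc (upTo k)) ⟩
  map downFrom (map (conj la) (map suc (upTo k)))
    ≡⟨ cong (map downFrom) (trans (sym (map-∘ (upTo k))) (map-upTo (conj la ∘ suc) k)) ⟩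
  map downFrom (conjugate k la) ∎)
  where open ≡-Reasoning

theorem4p12 : (n k s : ℕ) (la : Vec ℕ s) → 1 ≤ k → k ≤ n → IsPartition k la →
    (f : Poly n) → InV n la f → NonZeroP f →
    (c : Vec ℕ n) → IsLexLeading f c → InC n k s la c
theorem4p12 n k s la _ k≤n (_ , sum-la) f f∈V _ c lead =
  subst (λ ls → ∃ λ w → Shuffle ls w × Pointwise _≤_ (Vec.toList c) w)
    (sym (blocks≡columns n k s la))
    (leading-exponent-bounded s (conjugate k la) (n ∸ k) (dual f) c
      (applyUpTo⁺₁ (conj la ∘ suc) k (λ i<j _ → conj-antitone la (s≤s (<⇒≤ i<j))))
      -- The columns hold k boxes, and the constant sequence supplies the other n - k letters.
      (trans (cong (_+ (n ∸ k)) (trans (sum-conjugate la (≤-reflexive sum-la)) sum-la))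
             (m+[n∸m]≡n k≤n))
      (dual-annihilates la f k≤n f∈V)
      (dual-lexLeading f lead))
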